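{- Let $f$ and $g$ be reversible cellular automata on $\Sigma^{\mathbb Z}$ and let $n\ge 0$ be an integer. If $\mathcal N(f)$, $\tilde{\mathcal N}(f)$, $\mathcal N(g)$ and $\tilde{\mathcal N}(g)$ are all included in $[-n,n]\cap\mathbb Z$, then $\mathcal{BN}(fg)\subseteq[-4n,4n]\cap\mathbb Z$.
   Context: $\Sigma$ is a finite nonempty alphabet. A (one-dimensional) cellular automaton (CA) on $\Sigma$ is a translation-invariant map $f:\Sigma^{\mathbb Z}\to\Sigma^{\mathbb Z}$ for which $f(v)_0$ depends only on finitely many coordinates of $v$; it is reversible if it is bijective (its inverse is then also a CA). $fg$ denotes the composition $f\circ g$. For $X\subseteq\mathbb Z$, $\bar X=\mathbb Z\setminus X$, and $\Sigma^{\mathbb Z}$ is identified with $\Sigma^X\times\Sigma^{\bar X}$. Neighborhoods: $\mathcal N(f)$ is the smallest $A\subseteq\mathbb Z$ such that $v|_A$ determines $f(v)_0$. The dual of a reversible CA $f$ is $\tilde f=S f^{ -1}S$, where $S(a)_n=a_{ -n}$ on $\Sigma^{\mathbb Z}$, and the dual neighborhood is $\tilde{\mathcal N}(f)=\mathcal N(\tilde f)$. Semilocalizable: a bijection $F:A\times B\to C\times D$ is semilocalizable if there exist a set $E$ and bijections $g:A\to C\times E$ and $h:D\to B\times E$ such that for all $a\in A,b\in B$, $F(a,b)=\bigl(g_C(a),\,h^{ -1}(b,g_E(a))\bigr)$, where $g(a)=(g_C(a),g_E(a))$. For $X,Y\subseteq\mathbb Z$, $\mathbf{Q}_X^Y(f)$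 is the property: "$f$, seen as a function from $\Sigma^X\times\Sigma^{\bar X}$ to $\Sigma^Y\times\Sigma^{\bar Y}$, is semilocalizable". The block neighborhood $\mathcal{BN}(f)$ is the smallest (for inclusion) $X\subseteq\mathbb Z$ such that $\mathbf{Q}_X^{\{0\}}(f)$ holds. -}

module Defs where

open import Level using (Level; 0ℓ) renaming (suc to lsuc)
open import Data.Bool.Base using (Bool; true; false; not; T; _∧_)
open import Data.Integer.Base using (ℤ; 0ℤ; _+_; -_; _≤ᵇ_)
open import Data.Integer.Properties using (_≟_)
open import Data.List.Base using (List)
import Data.List.Membership.Propositional as List
open import Data.Product.Base using (_×_; _,_; proj₁; proj₂; ∃; ∃-syntax)
open import Data.Product.Relation.Binary.Pointwise.NonDependent using (_×ₛ_)
open import Data.Unit.Base using (tt)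
open import Function.Bundles using (Inverse)
import Function.Construct.Composition as Composition
import Function.Construct.Symmetry as Symmetry
open import Relation.Binary.Bundles using (Setoid)
open import Relation.Binary.PropositionalEquality
  using (_≡_; refl; trans; _≗_; _→-setoid_)
open import Relation.Nullary.Decidable.Core using (⌊_⌋)

private
  variable
    ℓ : Level

-- Subsets of ℤ are Bool-valued: the identification of Γ^ℤ with Γ^X × Γ^X̄
-- requires membership in X to be decidable.

Subset : Set
Subset = ℤ → Bool

infix 4 _∈_ _⊆_

_∈_ : ℤ → Subset → Set
i ∈ X = T (X i)

_⊆_ : Subset → Subset → Set
X ⊆ Y = ∀ i → i ∈ X → i ∈ Y

∁ : Subset → Subset
∁ X i = not (X i)

｛0｝ : Subset
｛0｝ i = ⌊ i ≟ 0ℤ ⌋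

⟦_,_⟧ : ℤ → ℤ → Subset
⟦ a , b ⟧ i = (a ≤ᵇ i) ∧ (i ≤ᵇ b)

IsSmallest : (Subset → Set ℓ) → Subset → Set ℓ
IsSmallest P X = P X × (∀ Y → P Y → X ⊆ Y)

-- "The smallest X satisfying P is included in I", read as a definite
-- description: the smallest X exists (it is then unique up to extensional
-- equality), and it is included in I.

Smallest_⊆_ : (Subset → Set ℓ) → Subset → Set ℓ
Smallest P ⊆ I = ∃[ X ] IsSmallest P X × X ⊆ I

-- Equality in Γ^ℤ and in Γ^X is pointwise equality of functions.

Config : Set → Set
Config Γ = ℤ → Γ

Configₛ : Set → Setoid 0ℓ 0ℓ
Configₛ Γ = ℤ →-setoid Γ

_^_ : Set → Subset → Setoid 0ℓ 0ℓ
Γ ^ X = (∃ λ i → i ∈ X) →-setoid Γ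

module _ {A : Set} where

  choose : (b : Bool) → (T b → A) → (T (not b) → A) → A
  choose true  k l = k tt
  choose false k l = l tt

  choose-const : ∀ b (x : A) → choose b (λ _ → x) (λ _ → x) ≡ x
  choose-const true  x = refl
  choose-const false x = refl

  choose-cong : ∀ b {k k′ l l′} → k ≗ k′ → l ≗ l′ →
                choose b k l ≡ choose b k′ l′
  choose-cong true  k≗k′ l≗l′ = k≗k′ tt
  choose-cong false k≗k′ l≗l′ = l≗l′ tt

  choose-T : ∀ b (p : T b) k l → choose b k l ≡ k p
  choose-T true p k l = refl

  choose-not : ∀ b (p : T (not b)) k l → choose b k l ≡ l p
  choose-not false p k l = refl

split : {Γ : Set} (X : Subset) → Inverse (Configₛ Γ) ((Γ ^ X) ×ₛ (Γ ^ ∁ X))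
split X = record
  { to        = λ v → (λ (i , _) → v i) , (λ (i , _) → v i)
  ; from      = λ (a , b) i → choose (X i) (λ p → a (i , p)) (λ p → b (i , p))
  ; to-cong   = λ v≗w → (λ (i , _) → v≗w i) , (λ (i , _) → v≗w i)
  ; from-cong = λ (a≗a′ , b≗b′) i →
                  choose-cong (X i) (λ p → a≗a′ (i , p)) (λ p → b≗b′ (i , p))
  ; inverse   =
      (λ v≗ → (λ (i , p) → trans (v≗ i) (choose-T   (X i) p _ _))
            , (λ (i , p) → trans (v≗ i) (choose-not (X i) p _ _)))
    , (λ {v} (a≗v , b≗v) i →
         trans (choose-cong (X i) (λ p → a≗v (i , p)) (λ p → b≗v (i , p)))
               (choose-const (X i) (v i)))
  }

translate : {Γ : Set} → ℤ → Config Γ → Config Γ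
translate k v i = v (i + k)

record IsCellularAutomaton {Γ : Set} (F : Config Γ → Config Γ) : Set where
  field
    translation-invariant : ∀ k v → F (translate k v) ≗ translate k (F v)
    local : ∃[ L ] ∀ v w → (∀ i → i List.∈ L → v i ≡ w i) → F v 0ℤ ≡ F w 0ℤ

record ReversibleCA (Γ : Set) : Set where
  field
    bijection           : Inverse (Configₛ Γ) (Configₛ Γ)
    isCellularAutomaton : IsCellularAutomaton (Inverse.to bijection)

  map : Config Γ → Config Γ
  map = Inverse.to bijection

  map⁻¹ : Config Γ → Config Γ
  map⁻¹ = Inverse.from bijection

open ReversibleCA public using (bijection; map; map⁻¹)

reflect : {Γ : Set} → Config Γ → Config Γ
reflect v i = v (- i)

dual : {Γ : Set} → ReversibleCA Γ → Config Γ → Config Γ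
dual f v = reflect (map⁻¹ f (reflect v))

composition : {Γ : Set} → ReversibleCA Γ → ReversibleCA Γ →
              Inverse (Configₛ Γ) (Configₛ Γ)
composition f g = Composition.inverse (bijection g) (bijection f)

Determines : {Γ : Set} → (Config Γ → Config Γ) → Subset → Set
Determines F A = ∀ v w → (∀ i → i ∈ A → v i ≡ w i) → F v 0ℤ ≡ F w 0ℤ

𝒩[_]⊆_ : {Γ : Set} → (Config Γ → Config Γ) → Subset → Set
𝒩[ F ]⊆ I = Smallest (Determines F) ⊆ I

𝒩̃[_]⊆_ : {Γ : Set} → ReversibleCA Γ → Subset → Set
𝒩̃[ f ]⊆ I = 𝒩[ dual f ]⊆ I

Semilocalizable : {A B C D : Setoid 0ℓ 0ℓ} →
                  Inverse (A ×ₛ B) (C ×ₛ D) → Set (lsuc 0ℓ)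
Semilocalizable {A} {B} {C} {D} F =
  ∃ λ (E : Setoid 0ℓ 0ℓ) → ∃ λ (g : Inverse A (C ×ₛ E)) →
  ∃ λ (h : Inverse D (B ×ₛ E)) →
    ∀ a b → let (gC , gE) = Inverse.to g a in
      Setoid._≈_ (C ×ₛ D) (Inverse.to F (a , b)) (gC , Inverse.from h (b , gE))

-- φ seen as a bijection Γ^X × Γ^X̄ → Γ^Y × Γ^Ȳ

seenAs : {Γ : Set} (X Y : Subset) → Inverse (Configₛ Γ) (Configₛ Γ) →
         Inverse ((Γ ^ X) ×ₛ (Γ ^ ∁ X)) ((Γ ^ Y) ×ₛ (Γ ^ ∁ Y))
seenAs X Y φ =
  Composition.inverse (Composition.inverse (Symmetry.inverse (split X)) φ) (split Y)

𝐐 : {Γ : Set} (X Y : Subset) → Inverse (Configₛ Γ) (Configₛ Γ) → Set (lsuc 0ℓ)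
𝐐 X Y φ = Semilocalizable (seenAs X Y φ)

ℬ𝒩[_]⊆_ : {Γ : Set} → Inverse (Configₛ Γ) (Configₛ Γ) → Subset → Set (lsuc 0ℓ)
ℬ𝒩[ φ ]⊆ I = Smallest (λ X → 𝐐 X ｛0｝ φ) ⊆ I

{-# OPTIONS --safe #-}

-- 𝐐 X ｛0｝ φ says that for every letter c the map v ↦ φ⁻¹(φ(v) with c written
-- at 0) only touches coordinates in X and does so looking only at X. Such maps
-- behave well under conjugation: if G modifies only [-m,m] and reads only [-k,k]
-- with m + 2n ≤ k, then conjugating it by a CA of radius n (both ways) gives
-- m + n and k + n. Writing at the origin has (m,k) = (0,2n); conjugating by f
-- and then g gives (n,3n) and (2n,4n). The smallest X consists of the
-- coordinates j such that ∁{j} is not a support, which is decidable because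
-- [-4n,4n] is finite.

module Submission where

open import Defs
open import Level using (0ℓ)
open import Data.Bool.Base using (true; false)
open import Data.Bool.Properties using (T-∧; T?)
open import Data.Fin.Base as Fin using (Fin)
import Data.Fin.Properties as Fin
open import Data.Integer.Base as ℤ using (ℤ; +_; -[1+_]; -_; ∣_∣; 0ℤ)
import Data.Integer.Properties as ℤ
open import Data.List.Base as List using (List; []; _∷_; _++_; upTo)
open import Data.List.Membership.Propositional.Properties
  using (∈-map⁺; ∈-upTo⁺; ∈-++⁺ˡ; ∈-++⁺ʳ)
open import Data.List.Relation.Unary.All as All using (All)
open import Data.List.Relation.Unary.Any using (here; there)
import Data.List.Membership.Propositional as List
open import Data.Nat.Base as ℕ using (ℕ; suc; _*_; _≤_; s≤s)
import Data.Nat.Properties as ℕ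
open import Data.Nat.Tactic.RingSolver using (solve)
open import Data.Product.Base using (_×_; _,_; proj₁; proj₂; ∃-syntax)
open import Data.Product.Relation.Binary.Pointwise.NonDependent using (_×ₛ_)
open import Data.Sum.Base as Sum using (_⊎_; inj₁; inj₂)
open import Function.Base using (_∘_; id)
open import Function.Bundles using (_↔_; Inverse; Equivalence)
open import Function.Properties.Inverse using (↔⇒↣)
open import Relation.Binary.Bundles using (Setoid)
open import Relation.Binary.Definitions using (DecidableEquality)
open import Relation.Binary.PropositionalEquality
open import Relation.Nullary.Negation using (¬_; contradiction)
open import Relation.Nullary.Decidable
  using (Dec; yes; no; ⌊_⌋; isNo; map′; via-injection; _×-dec_; _→-dec_;
         toWitness; fromWitnessFalse; toWitnessFalse; decidable-stable)
open import Relation.Unary using (Pred; Decidable)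

-- Semilocalizability as a property of overwriting the C-part of the image.

module _ {A B C D : Setoid 0ℓ 0ℓ} (F : Inverse (A ×ₛ B) (C ×ₛ D)) where

  private
    module A = Setoid A
    module B = Setoid B
    module C = Setoid C
    module D = Setoid D
    module F = Inverse F

  overwrite : C.Carrier → A.Carrier → B.Carrier → A.Carrier × B.Carrier
  overwrite c a b = F.from (c , proj₂ (F.to (a , b)))

  -- This form speaks of `F` alone, without the existentially quantified `E`, `g` and `h`, so it can
  -- be checked directly on configurations.
  record Localized : Set where
    field
      preserves : ∀ c a b → proj₂ (overwrite c a b) B.≈ b
      ignores   : ∀ c a b b′ →
                  proj₁ (overwrite c a b) A.≈ proj₁ (overwrite c a b′)

  -- Since `F` is injective, overwriting must yield `g.from (c , gE)` paired with `b`: the A-part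
  -- does not mention `b`, and the B-part is untouched.
  semilocalizable⇒localized : Semilocalizable F → Localized
  semilocalizable⇒localized (E , g , h , F≈) = record
    { preserves = λ c a b → proj₂ (overwrite≈ c a b)
    ; ignores   = λ c a b b′ →
        A.trans (proj₁ (overwrite≈ c a b)) (A.sym (proj₁ (overwrite≈ c a b′)))
    }
    where
    module g = Inverse g
    module h = Inverse h
    overwrite≈ : ∀ c a b → Setoid._≈_ (A ×ₛ B) (overwrite c a b)
                                     (g.from (c , proj₂ (g.to a)) , b)
    overwrite≈ c a b =
      let a′ = g.from (c , proj₂ (g.to a))
          (C≈ , E≈) = g.strictlyInverseˡ (c , proj₂ (g.to a))
          (FC , FD) = F≈ a′ b
      in F.inverseʳ
           ( C.sym (C.trans FC C≈)
           , D.trans (proj₂ (F≈ a b))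
               (D.sym (D.trans FD (h.from-cong (B.refl , E≈)))) )

  -- E is A modulo equality of the D-parts of the images under F(-,b₀); this does
  -- not depend on b₀, because overwriting C loses nothing but the C-part.
  localized⇒semilocalizable : C.Carrier → B.Carrier → Localized → Semilocalizable F
  localized⇒semilocalizable c₀ b₀ loc = E , g , h , λ a b → C-part a b b₀ , D.refl
    where
    open Localized loc

    FC : A.Carrier → B.Carrier → C.Carrier
    FC a b = proj₁ (F.to (a , b))

    FD : A.Carrier → B.Carrier → D.Carrier
    FD a b = proj₂ (F.to (a , b))

    residual : C.Carrier → A.Carrier → A.Carrier
    residual c a = proj₁ (overwrite c a b₀)

    to-residual : ∀ c a b → Setoid._≈_ (C ×ₛ D) (F.to (residual c a , b)) (c , FD a b)
    to-residual c a b =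
      F.inverseˡ (ignores c a b₀ b , B.sym (preserves c a b))

    -- Overwriting with the C-part already present returns `a`. By `ignores` the same A-part results
    -- from `b′`, where the image has C-part `c` by construction.
    C-part : ∀ a b b′ → FC a b C.≈ FC a b′
    C-part a b b′ = C.sym (C.trans
      (proj₁ (F.to-cong (A.trans (A.sym a≈) (ignores c a b b′) , B.refl)))
      (proj₁ (F.inverseˡ (A.refl , B.sym (preserves c a b′)))))
      where
      c = FC a b
      a≈ : proj₁ (overwrite c a b) A.≈ a
      a≈ = proj₁ (F.strictlyInverseʳ (a , b))

    E : Setoid 0ℓ 0ℓ
    E = record
      { Carrier = A.Carrier
      ; _≈_     = λ e e′ → FD e b₀ D.≈ FD e′ b₀
      ; isEquivalence = record { refl = D.refl ; sym = D.sym ; trans = D.trans }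
      }

    FD-cong : ∀ {a a′ b b′} → FD a b₀ D.≈ FD a′ b₀ → b B.≈ b′ → FD a b D.≈ FD a′ b′
    FD-cong {a} {a′} {b} {b′} e b≈b′ =
      D.trans (D.sym (proj₂ (to-residual c₀ a b)))
        (D.trans (proj₂ (F.to-cong (proj₁ (F.from-cong (C.refl , e)) , b≈b′)))
                 (proj₂ (to-residual c₀ a′ b′)))

    g : Inverse A (C ×ₛ E)
    g = record
      { to        = λ a → FC a b₀ , a
      ; from      = λ (c , e) → residual c e
      ; to-cong   = λ a≈ → F.to-cong (a≈ , B.refl)
      ; from-cong = λ ce≈ → proj₁ (F.from-cong ce≈)
      ; inverse   =
          (λ {(c , e)} a≈ →
             let (p , q) = F.to-cong (a≈ , B.refl)
                 (r , s) = to-residual c e b₀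
             in C.trans p r , D.trans q s)
        , (λ {a} ce≈ → proj₁ (F.inverseʳ ce≈))
      }

    h : Inverse D (B ×ₛ E)
    h = record
      -- The choice of `c₀` is immaterial: `E` identifies elements that differ only by overwriting
      -- the C-part.
      { to        = λ d → let (a , b) = F.from (c₀ , d) in b , a
      ; from      = λ (b , e) → FD e b
      ; to-cong   = to-cong
      ; from-cong = λ (b≈ , e≈) → FD-cong e≈ b≈
      ; inverse   =
          (λ {(b , e)} d≈ →
             let (p , q) = to-cong d≈
             in B.trans p (preserves c₀ e b)
              , D.trans q (D.trans
                  (proj₂ (F.to-cong (ignores c₀ e b b₀ , B.refl)))
                  (proj₂ (to-residual c₀ e b₀))))
        , (λ {d} (b≈ , e≈) →
             D.trans (FD-cong e≈ b≈) (proj₂ (F.strictlyInverseˡ (c₀ , d))))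
      }
      where
      to-cong : ∀ {d d′} → d D.≈ d′ →
                (proj₂ (F.from (c₀ , d)) B.≈ proj₂ (F.from (c₀ , d′))) ×
                (FD (proj₁ (F.from (c₀ , d))) b₀ D.≈ FD (proj₁ (F.from (c₀ , d′))) b₀)
      to-cong d≈ =
        let (a≈ , b≈) = F.from-cong (C.refl , d≈)
        in b≈ , proj₂ (F.to-cong (a≈ , B.refl))

-- Gates and single-coordinate updates.

-- M: coordinates that may be modified; R: coordinates that may be read (the
-- output at i may also depend on the input at i itself).

record Gate {Γ : Set} (M R : Pred ℤ 0ℓ) (G : Config Γ → Config Γ) : Set where
  field
    fixes : ∀ v i → ¬ M i → G v i ≡ v i
    reads : ∀ v w → (∀ i → R i → v i ≡ w i) → ∀ i → v i ≡ w i → G v i ≡ G w i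

weaken : {Γ : Set} {M M′ R R′ : Pred ℤ 0ℓ} {G : Config Γ → Config Γ} →
         (∀ i → M i → M′ i) → (∀ i → R i → R′ i) → Gate M R G → Gate M′ R′ G
weaken M⊆ R⊆ G = record
  { fixes = λ v i i∉ → fixes v i (i∉ ∘ M⊆ i)
  ; reads = λ v w v≡w → reads v w (λ i → v≡w i ∘ R⊆ i)
  } where open Gate G

module _ {Γ : Set} where

  update : ℤ → Γ → Config Γ → Config Γ
  update j x v i = choose ⌊ i ℤ.≟ j ⌋ (λ _ → x) (λ _ → v i)

  update-other : ∀ j x (v : Config Γ) i → i ≢ j → v i ≡ update j x v i
  update-other j x v i i≢j with i ℤ.≟ j
  ... | yes i≡j = contradiction i≡j i≢j
  ... | no _    = refl

  update-cong : ∀ j x (v w : Config Γ) i → v i ≡ w i → update j x v i ≡ update j x w i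
  update-cong j x v w i eq = choose-cong ⌊ i ℤ.≟ j ⌋ (λ _ → refl) (λ _ → eq)

  update-from-same : ∀ j (v w : Config Γ) → update j (w j) v j ≡ w j
  update-from-same j v w with j ℤ.≟ j
  ... | yes _  = refl
  ... | no j≢j = contradiction refl j≢j

  update-from : ∀ j (v w : Config Γ) i → v i ≡ w i → update j (w j) v i ≡ w i
  update-from j v w i eq with i ℤ.≟ j
  ... | yes refl = refl
  ... | no _     = eq

-- Decidability over a finite alphabet and the smallest support.

module Finite {Γ : Set} {k : ℕ} (Γ↔Fin : Γ ↔ Fin (suc k)) where

  open Inverse Γ↔Fin

  _≟_ : DecidableEquality Γ
  _≟_ = via-injection (↔⇒↣ Γ↔Fin) Fin._≟_

  all? : {P : Pred Γ 0ℓ} → Decidable P → Dec (∀ x → P x)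
  all? {P} P? = map′ (λ p x → subst P (strictlyInverseʳ x) (p (to x)))
                     (λ p i → p (from i))
                     (Fin.all? (P? ∘ from))

  -- As `P` depends only on the coordinates in `L`, it suffices to range over the letters there,
  -- starting from one constant configuration.
  allConfigs? : (L : List ℤ) {P : Pred (Config Γ) 0ℓ} → Decidable P →
                (∀ v w → (∀ i → i List.∈ L → v i ≡ w i) → P v → P w) →
                Dec (∀ v → P v)
  allConfigs? [] P? det =
    map′ (λ p v → det v₀ v (λ _ ()) p) (λ p → p v₀) (P? v₀)
    where
    v₀ : Config Γ
    v₀ _ = from Fin.zero
  allConfigs? (j ∷ L) {P} P? det =
    map′ (λ p v → det _ v (λ i _ → update-from j v v i refl) (p v (v j)))
         (λ p v x → p (update j x v))
         (allConfigs? L (λ v → all? (λ x → P? (update j x v)))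
           λ v w v≡w p x → det _ _ (agree v w x v≡w) (p x))
    where
    agree : ∀ v w x → (∀ i → i List.∈ L → v i ≡ w i) →
            ∀ i → i List.∈ j ∷ L → update j x v i ≡ update j x w i
    agree v w x v≡w i (there i∈L) = update-cong j x v w i (v≡w i i∈L)
    agree v w x v≡w i (here refl) with i ℤ.≟ i
    ... | yes _  = refl
    ... | no i≢i = contradiction refl i≢i

  module _ (L : List ℤ) where

    private
      Away : ℤ → Pred (Config Γ → Config Γ) 0ℓ
      Away j = Gate (_≢ j) (_≢ j)

      -- Two configurations that agree off `j` differ by one update at `j`, so a single new letter
      -- `x` replaces the second configuration and makes the condition finitely checkable.
      Test : ℤ → (Config Γ → Config Γ) → Config Γ → Γ → ℤ → Set
      Test j G v x i = (i ≡ j → G v i ≡ v i) ×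
                       (v i ≡ update j x v i → G v i ≡ G (update j x v) i)

    away? : ∀ {G} → Gate (List._∈ L) (List._∈ L) G → ∀ j → Dec (Away j G)
    away? {G} gate j =
      map′ test⇒away away⇒test
        (allConfigs? L (λ v → all? λ x → All.all? (test? v x) L) det)
      where
      open Gate gate
      open import Data.List.Membership.DecPropositional ℤ._≟_ using (_∈?_)

      test? : ∀ v x → Decidable (Test j G v x)
      test? v x i = ((i ℤ.≟ j) →-dec (G v i ≟ v i)) ×-dec
                    ((v i ≟ update j x v i) →-dec (G v i ≟ G (update j x v) i))

      det : ∀ v w → (∀ i → i List.∈ L → v i ≡ w i) →
            (∀ x → All (Test j G v x) L) → ∀ x → All (Test j G w x) L
      det v w v≡w t x = All.tabulate λ {i} i∈L →
        let (fix , read) = All.lookup (t x) i∈L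
            vi≡wi  = v≡w i i∈L
            upd≡ i = update-cong j x v w i
            Gv≡Gw  = reads v w v≡w i vi≡wi
        in (λ i≡j → trans (sym Gv≡Gw) (trans (fix i≡j) vi≡wi))
         , (λ wi≡ → trans (sym Gv≡Gw) (trans
              (read (trans vi≡wi (trans wi≡ (sym (upd≡ i vi≡wi)))))
              (reads _ _ (λ i i∈L → upd≡ i (v≡w i i∈L)) i (upd≡ i vi≡wi))))

      away⇒test : Away j G → ∀ v x → All (Test j G v x) L
      away⇒test away v x = All.tabulate λ {i} _ →
          (λ i≡j → Gate.fixes away v i (λ i≢j → i≢j i≡j))
        , Gate.reads away v (update j x v) (update-other j x v) i

      test⇒away : (∀ v x → All (Test j G v x) L) → Away j G
      test⇒away t = record { fixes = fix ; reads = read }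
        where
        fix : ∀ v i → ¬ (i ≢ j) → G v i ≡ v i
        fix v i ¬i≢j with i ∈? L
        ... | no i∉L  = fixes v i i∉L
        -- The letter is arbitrary here; `¬i≢j` is a double negation, removed by decidability of
        -- equality on integers.
        ... | yes i∈L = proj₁ (All.lookup (t v (v i)) i∈L)
                              (decidable-stable (i ℤ.≟ j) ¬i≢j)
        read : ∀ v w → (∀ i → i ≢ j → v i ≡ w i) → ∀ i → v i ≡ w i → G v i ≡ G w i
        read v w v≡w i vi≡wi with i ∈? L
        ... | no i∉L  = trans (fixes v i i∉L) (trans vi≡wi (sym (fixes w i i∉L)))
        ... | yes i∈L =
          trans (proj₂ (All.lookup (t v (w j)) i∈L) (trans vi≡wi (sym (v′≡w i))))
                (reads _ _ (λ i _ → v′≡w i) i (v′≡w i))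
          where
          v′≡w : ∀ i → update j (w j) v i ≡ w i
          v′≡w i with i ℤ.≟ j
          ... | yes refl = refl
          ... | no i≢j   = v≡w i i≢j

    smallestSupport : (G : Γ → Config Γ → Config Γ) →
      (∀ c → Gate (List._∈ L) (List._∈ L) (G c)) →
      ∃[ X ] IsSmallest (λ X → ∀ c → Gate (_∈ X) (_∈ X) (G c)) X
    smallestSupport G gate = X , (λ c → record { fixes = fix c ; reads = read c }) , minimal
      where
      inessential? : ∀ j → Dec (∀ c → Away j (G c))
      inessential? j = all? λ c → away? (gate c) j

      X : Subset
      X j = isNo (inessential? j)

      minimal : ∀ Y → (∀ c → Gate (_∈ Y) (_∈ Y) (G c)) → X ⊆ Y
      minimal Y gateY j j∈X with T? (Y j)
      ... | yes j∈Y = j∈Y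
      -- A support that omits `j` lies in the complement of `j`, which makes `j` inessential.
      ... | no  j∉Y = contradiction (λ c → weaken Y⊆ Y⊆ (gateY c)) (toWitnessFalse j∈X)
        where
        Y⊆ : ∀ i → i ∈ Y → i ≢ j
        Y⊆ i i∈Y refl = j∉Y i∈Y

      fix : ∀ c v i → ¬ (i ∈ X) → G c v i ≡ v i
      fix c v i i∉X with inessential? i
      ... | yes away = Gate.fixes (away c) v i (λ i≢i → i≢i refl)
      ... | no  _    = contradiction _ i∉X

      -- v is turned into w one coordinate of L at a time; a coordinate where
      -- they differ lies outside X, so changing it does not affect the output.
      hybrid : ∀ c L′ v w → (∀ j → j ∈ X → v j ≡ w j) →
               (∀ j → j List.∈ L → j List.∈ L′ ⊎ v j ≡ w j) →
               ∀ i → v i ≡ w i → G c v i ≡ G c w i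
      hybrid c [] v w _ v≡w i =
        Gate.reads (gate c) v w (λ j j∈L → Sum.[ (λ ()) , id ] (v≡w j j∈L)) i
      hybrid c (j ∷ L′) v w onX v≡w i vi≡wi with inessential? j
      ... | yes away =
        trans (Gate.reads (away c) v v′ (update-other j (w j) v) i
                (trans vi≡wi (sym (v′≡w i vi≡wi))))
              (hybrid c L′ v′ w (λ k → v′≡w k ∘ onX k) step i (v′≡w i vi≡wi))
        where
        v′ : Config Γ
        v′ = update j (w j) v
        v′≡w : ∀ k → v k ≡ w k → v′ k ≡ w k
        v′≡w = update-from j v w
        step : ∀ k → k List.∈ L → k List.∈ L′ ⊎ v′ k ≡ w k
        step k k∈L with v≡w k k∈L
        ... | inj₁ (here refl) = inj₂ (update-from-same j v w)
        ... | inj₁ (there k∈)  = inj₁ k∈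
        ... | inj₂ vk≡wk       = inj₂ (v′≡w k vk≡wk)
      ... | no ¬away = hybrid c L′ v w onX step i vi≡wi
        where
        step : ∀ k → k List.∈ L → k List.∈ L′ ⊎ v k ≡ w k
        step k k∈L with v≡w k k∈L
        ... | inj₁ (here refl) = inj₂ (onX j (fromWitnessFalse ¬away))
        ... | inj₁ (there k∈)  = inj₁ k∈
        ... | inj₂ vk≡wk       = inj₂ vk≡wk

      read : ∀ c v w → (∀ i → i ∈ X → v i ≡ w i) → ∀ i → v i ≡ w i → G c v i ≡ G c w i
      read c v w onX = hybrid c L v w onX (λ _ → inj₁)

-- Equivalence of `𝐐` with a gate condition on rewriting the origin.

∈∁⇒∉ : ∀ X i → i ∈ ∁ X → ¬ (i ∈ X)
∈∁⇒∉ X i i∈∁ i∈ with X i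
... | false = i∈
... | true  = i∈∁

∉⇒∈∁ : ∀ X i → ¬ (i ∈ X) → i ∈ ∁ X
∉⇒∈∁ X i i∉ with X i
... | false = _
... | true  = i∉ _

module _ {Γ : Set} (φ : Inverse (Configₛ Γ) (Configₛ Γ)) where

  private module φ = Inverse φ

  rewriteOrigin : Γ → Config Γ → Config Γ
  rewriteOrigin c v = φ.from (update 0ℤ c (φ.to v))

  module _ (X : Subset) where

    private module X = Inverse (split {Γ} X)

    blocks : Inverse ((Γ ^ X) ×ₛ (Γ ^ ∁ X)) ((Γ ^ ｛0｝) ×ₛ (Γ ^ ∁ ｛0｝))
    blocks = seenAs X ｛0｝ φ

    gates⇒localized : (∀ c → Gate (_∈ X) (_∈ X) (rewriteOrigin c)) → Localized blocks
    gates⇒localized gate = record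
      { preserves = λ c a b (i , p) →
          trans (overwrite≗ c a b i)
            (trans (Gate.fixes (gate _) (X.from (a , b)) i (∈∁⇒∉ X i p))
                   (choose-not (X i) p _ _))
      ; ignores   = λ c a b b′ (i , p) →
          let same = λ i p → trans (choose-T (X i) p _ _) (sym (choose-T (X i) p _ _))
          in trans (overwrite≗ c a b i)
               (trans (Gate.reads (gate _) (X.from (a , b)) (X.from (a , b′)) same i (same i p))
                      (sym (overwrite≗ c a b′ i)))
      }
      where
      -- The index type has only the coordinate 0, so such a `c` amounts to a single letter.
      const≡ : (c : Setoid.Carrier (Γ ^ ｛0｝)) → ∀ i p → c (i , p) ≡ c (0ℤ , _)
      const≡ c i p with toWitness {a? = i ℤ.≟ 0ℤ} p
      ... | refl = refl

      overwrite≗ : ∀ c a b →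
        φ.from (Inverse.from (split ｛0｝)
                 (c , proj₂ (Inverse.to (split ｛0｝) (φ.to (X.from (a , b))))))
        ≗ rewriteOrigin (c (0ℤ , _)) (X.from (a , b))
      overwrite≗ c a b = φ.from-cong λ i →
        choose-cong (｛0｝ i) (const≡ c i) (λ _ → refl)

    localized⇒gates : Localized blocks → ∀ c → Gate (_∈ X) (_∈ X) (rewriteOrigin c)
    localized⇒gates loc c = record { fixes = fix ; reads = read }
      where
      open Localized loc

      cong-rewrite : ∀ {v w} → v ≗ w → rewriteOrigin c v ≗ rewriteOrigin c w
      cong-rewrite {v} {w} v≗w = φ.from-cong λ i →
        update-cong 0ℤ c (φ.to v) (φ.to w) i (φ.to-cong v≗w i)

      fix : ∀ v i → ¬ (i ∈ X) → rewriteOrigin c v i ≡ v i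
      fix v i i∉X =
        trans (cong-rewrite (sym ∘ X.strictlyInverseʳ v) i)
              (preserves (λ _ → c) _ _ (i , ∉⇒∈∁ X i i∉X))

      read : ∀ v w → (∀ i → i ∈ X → v i ≡ w i) → ∀ i → v i ≡ w i →
             rewriteOrigin c v i ≡ rewriteOrigin c w i
      read v w v≡w i vi≡wi with T? (X i)
      ... | no i∉X  = trans (fix v i i∉X) (trans vi≡wi (sym (fix w i i∉X)))
      ... | yes i∈X =
        trans (cong-rewrite (sym ∘ X.strictlyInverseʳ v) i)
          -- `ignores` exchanges the part of `v` outside `X` for that of `w`; the resulting mixture
          -- equals `w`, because `v` and `w` agree on `X`.
          (trans (ignores (λ _ → c) _ _ _ (i , i∈X))
                 (cong-rewrite (X.inverseʳ {x = w} ((λ (i , p) → v≡w i p) , λ _ → refl)) i))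

    gates⇒𝐐 : Γ → (∀ c → Gate (_∈ X) (_∈ X) (rewriteOrigin c)) → 𝐐 X ｛0｝ φ
    gates⇒𝐐 x gate = localized⇒semilocalizable blocks (λ _ → x) (λ _ → x) (gates⇒localized gate)

    𝐐⇒gates : 𝐐 X ｛0｝ φ → ∀ c → Gate (_∈ X) (_∈ X) (rewriteOrigin c)
    𝐐⇒gates q = localized⇒gates (semilocalizable⇒localized blocks q)

-- Symmetric intervals and the triangle inequality.

Ball : ℕ → Pred ℤ 0ℓ
Ball n i = ∣ i ∣ ≤ n

⟦⟧⇒Ball : ∀ n i → i ∈ ⟦ - (+ n) , + n ⟧ → Ball n i
⟦⟧⇒Ball n i i∈ with Equivalence.to (T-∧ { - (+ n) ℤ.≤ᵇ i} {i ℤ.≤ᵇ + n}) i∈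
⟦⟧⇒Ball n (+ m) i∈ | _ , m≤n with ℤ.≤ᵇ⇒≤ {+ m} {+ n} m≤n
... | ℤ.+≤+ m≤n = m≤n
⟦⟧⇒Ball (suc n) -[1+ m ] i∈ | n≤m , _ with ℤ.≤ᵇ⇒≤ { -[1+ n ]} { -[1+ m ]} n≤m
... | ℤ.-≤- m≤n = s≤s m≤n

Ball⇒⟦⟧ : ∀ n i → Ball n i → i ∈ ⟦ - (+ n) , + n ⟧
Ball⇒⟦⟧ n (+ m) m≤n =
  Equivalence.from T-∧ (ℤ.≤⇒≤ᵇ (ℤ.neg-≤-pos {n} {m}) , ℤ.≤⇒≤ᵇ (ℤ.+≤+ m≤n))
Ball⇒⟦⟧ (suc n) -[1+ m ] (s≤s m≤n) =
  Equivalence.from (T-∧ {y = true}) (ℤ.≤⇒≤ᵇ (ℤ.-≤- m≤n) , _)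

ball : ℕ → List ℤ
ball n = List.map +_ (upTo (suc n)) ++ List.map (λ m → - (+ m)) (upTo (suc n))

Ball⇒∈ball : ∀ n i → Ball n i → i List.∈ ball n
Ball⇒∈ball n (+ m)    m≤n = ∈-++⁺ˡ (∈-map⁺ +_ (∈-upTo⁺ (s≤s m≤n)))
Ball⇒∈ball n -[1+ m ] m≤n =
  ∈-++⁺ʳ (List.map +_ (upTo (suc n))) (∈-map⁺ (λ m → - (+ m)) (∈-upTo⁺ (s≤s m≤n)))

Ball-+ : ∀ {m n} i j → Ball n i → Ball m j → Ball (m ℕ.+ n) (i ℤ.+ j)
Ball-+ {m} {n} i j i≤n j≤m =
  ℕ.≤-trans (ℤ.∣i+j∣≤∣i∣+∣j∣ i j)
    (ℕ.≤-trans (ℕ.+-mono-≤ i≤n j≤m) (ℕ.≤-reflexive (ℕ.+-comm n m)))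

Ball-cancel : ∀ {m n} i j → Ball n i → Ball m (i ℤ.+ j) → Ball (m ℕ.+ n) j
Ball-cancel {m} {n} i j i≤n i+j≤m =
  subst (Ball (m ℕ.+ n)) -i+[i+j]≡j
    (Ball-+ (- i) (i ℤ.+ j) (subst (_≤ n) (sym (ℤ.∣-i∣≡∣i∣ i)) i≤n) i+j≤m)
  where
  -i+[i+j]≡j : - i ℤ.+ (i ℤ.+ j) ≡ j
  -i+[i+j]≡j = trans (sym (ℤ.+-assoc (- i) i j))
    (trans (cong (ℤ._+ j) (ℤ.+-inverseˡ i)) (ℤ.+-identityˡ j))

-- Radii of cellular automata and conjugation of gates.

module _ {Γ : Set} where

  -- Stated at every coordinate `k`, so that conjugation need not handle translations.
  Radius : ℕ → (Config Γ → Config Γ) → Set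
  Radius n F = ∀ v w k → (∀ i → Ball n i → v (i ℤ.+ k) ≡ w (i ℤ.+ k)) → F v k ≡ F w k

  determines⇒radius : ∀ {n F} → (∀ k v → F (translate k v) ≗ translate k (F v)) →
                      (∀ v w → (∀ i → Ball n i → v i ≡ w i) → F v 0ℤ ≡ F w 0ℤ) →
                      Radius n F
  determines⇒radius {F = F} invariant det v w k v≡w =
    subst (λ j → F v j ≡ F w j) (ℤ.+-identityˡ k)
      (trans (sym (invariant k v 0ℤ))
        (trans (det (translate k v) (translate k w) v≡w) (invariant k w 0ℤ)))

  map-radius : ∀ n (f : ReversibleCA Γ) → 𝒩[ map f ]⊆ ⟦ - (+ n) , + n ⟧ → Radius n (map f)
  map-radius n f (X , (det , _) , X⊆) =
    determines⇒radius
      (IsCellularAutomaton.translation-invariant (ReversibleCA.isCellularAutomaton f))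
      λ v w v≡w → det v w λ i i∈X → v≡w i (⟦⟧⇒Ball n i (X⊆ i i∈X))

  -- The inverse inherits translation invariance from `f`. The two reflections in the dual cancel at
  -- 0, and the ball is symmetric under negation.
  map⁻¹-radius : ∀ n (f : ReversibleCA Γ) → 𝒩̃[ f ]⊆ ⟦ - (+ n) , + n ⟧ → Radius n (map⁻¹ f)
  map⁻¹-radius n f (X , (det , _) , X⊆) = determines⇒radius invariant det⁻¹
    where
    open Inverse (bijection f)
    open IsCellularAutomaton (ReversibleCA.isCellularAutomaton f)

    invariant : ∀ k v → from (translate k v) ≗ translate k (from v)
    invariant k v = inverseʳ λ i →
      sym (trans (translation-invariant k (from v) i) (strictlyInverseˡ v (i ℤ.+ k)))

    reflect² : ∀ (v : Config Γ) → reflect (reflect v) ≗ v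
    reflect² v i = cong v (ℤ.neg-involutive i)

    det⁻¹ : ∀ v w → (∀ i → Ball n i → v i ≡ w i) → from v 0ℤ ≡ from w 0ℤ
    det⁻¹ v w v≡w =
      trans (sym (from-cong (reflect² v) 0ℤ))
        (trans (det (reflect v) (reflect w) λ i i∈X →
                  v≡w (- i) (subst (_≤ n) (sym (ℤ.∣-i∣≡∣i∣ i)) (⟦⟧⇒Ball n i (X⊆ i i∈X))))
               (from-cong (reflect² w) 0ℤ))

  -- On the ball of radius m + n the output depends on G's output on the ball of
  -- radius m + 2n, which lies inside the ball that G reads anyway.
  conjugate : ∀ {m k n G} (φ : Inverse (Configₛ Γ) (Configₛ Γ)) →
    Radius n (Inverse.to φ) → Radius n (Inverse.from φ) → m ℕ.+ n ℕ.+ n ≤ k →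
    Gate (Ball m) (Ball k) G →
    Gate (Ball (m ℕ.+ n)) (Ball (k ℕ.+ n)) (Inverse.from φ ∘ G ∘ Inverse.to φ)
  conjugate {m} {k} {n} {G} φ to-radius from-radius m+2n≤k gate =
    record { fixes = fix ; reads = read }
    where
    open Inverse φ

    fix : ∀ v i → ¬ Ball (m ℕ.+ n) i → from (G (to v)) i ≡ v i
    fix v i i∉ =
      -- The window of radius `n` around such an `i` misses the ball of radius `m`, so the inverse
      -- does not see what `G` changed.
      trans (from-radius (G (to v)) (to v) i λ j j≤n →
               Gate.fixes gate (to v) (j ℤ.+ i) (i∉ ∘ Ball-cancel j i j≤n))
            (strictlyInverseʳ v i)

    read : ∀ v w → (∀ i → Ball (k ℕ.+ n) i → v i ≡ w i) → ∀ i → v i ≡ w i →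
           from (G (to v)) i ≡ from (G (to w)) i
    read v w v≡w i vi≡wi with ∣ i ∣ ℕ.≤? m ℕ.+ n
    ... | no i∉  = trans (fix v i i∉) (trans vi≡wi (sym (fix w i i∉)))
    ... | yes i∈ = from-radius (G (to v)) (G (to w)) i λ j j≤n →
      Gate.reads gate (to v) (to w) to-v≡to-w (j ℤ.+ i)
        (to-v≡to-w (j ℤ.+ i) (ℕ.≤-trans (Ball-+ j i j≤n i∈) m+2n≤k))
      where
      to-v≡to-w : ∀ i → Ball k i → to v i ≡ to w i
      to-v≡to-w i i∈k = to-radius v w i λ j j≤n → v≡w (j ℤ.+ i) (Ball-+ j i j≤n i∈k)

  -- Each output depends at most on the input at the same coordinate, so `k` is free and can be
  -- chosen as the conjugations require.
  update-gate : ∀ k c → Gate (Ball 0) (Ball k) (update {Γ} 0ℤ c)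
  update-gate k c = record
    { fixes = λ v i i≰0 → sym (update-other 0ℤ c v i λ { refl → i≰0 ℕ.z≤n })
    ; reads = λ v w _ → update-cong 0ℤ c v w
    }

corollary2p5 : (Γ : Set) (k : ℕ) → Γ ↔ Fin (suc k) →
    (f g : ReversibleCA Γ) (n : ℕ) →
    𝒩[ map f ]⊆ ⟦ - (+ n) , + n ⟧ → 𝒩̃[ f ]⊆ ⟦ - (+ n) , + n ⟧ →
    𝒩[ map g ]⊆ ⟦ - (+ n) , + n ⟧ → 𝒩̃[ g ]⊆ ⟦ - (+ n) , + n ⟧ →
    ℬ𝒩[ composition f g ]⊆ ⟦ - (+ (4 * n)) , + (4 * n) ⟧
corollary2p5 Γ k Γ↔Fin f g n 𝒩f 𝒩̃f 𝒩g 𝒩̃g =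
  let (X , gateX , minimal) =
        smallestSupport (ball (4 * n)) (rewriteOrigin φ) (λ c →
          weaken (Ball⇒∈ball (4 * n)) (Ball⇒∈ball (4 * n)) (gate c))
  in X
   , ( gates⇒𝐐 φ X (Inverse.from Γ↔Fin Fin.zero) gateX
     , λ Y → minimal Y ∘ 𝐐⇒gates φ Y )
   -- The interval is itself a support, so it contains the smallest one.
   , minimal I λ c → weaken (Ball⇒⟦⟧ (4 * n)) (Ball⇒⟦⟧ (4 * n)) (gate c)
  where
  open Finite Γ↔Fin

  φ : Inverse (Configₛ Γ) (Configₛ Γ)
  φ = composition f g

  I : Subset
  I = ⟦ - (+ (4 * n)) , + (4 * n) ⟧

  4n≡ : n ℕ.+ n ℕ.+ n ℕ.+ n ≡ 4 * n
  4n≡ = solve (n ∷ [])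

  gate : ∀ c → Gate (Ball (4 * n)) (Ball (4 * n)) (rewriteOrigin φ c)
  gate c =
    weaken (λ i i≤ → ℕ.≤-trans i≤ 2n≤4n) (λ i i≤ → ℕ.≤-trans i≤ (ℕ.≤-reflexive 4n≡))
      -- The inverse of `fg` applies the inverse of `f` first, so `f` conjugates innermost. Starting
      -- from `k` = 2n, the bound m + 2n ≤ k holds with equality both times.
      (conjugate (bijection g) (map-radius n g 𝒩g) (map⁻¹-radius n g 𝒩̃g) ℕ.≤-refl
        (conjugate (bijection f) (map-radius n f 𝒩f) (map⁻¹-radius n f 𝒩̃f) ℕ.≤-refl
          (update-gate (n ℕ.+ n) c)))
    where
    2n≤4n : n ℕ.+ n ≤ 4 * n
    2n≤4n = ℕ.≤-trans (ℕ.≤-trans (ℕ.m≤m+n (n ℕ.+ n) n) (ℕ.m≤m+n _ n)) (ℕ.≤-reflexive 4n≡)
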